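{- Let $p>0$ be an integer, and let $T^p(n,k)$ ($n\ge 0$, $0\le k\le n$) be the integers defined in the context. Then for every integer $n>0$, $$\sum_{k=0}^{n}T^p(n,k)=A^p_n,\qquad\text{where}\qquad A^p_n=\frac{1}{pn+1}\binom{pn+1}{n}.$$
   Context: The numbers $A^p_n=\frac{1}{pn+1}\binom{pn+1}{n}$ are the Fuss-Catalan numbers. For every integer $p>0$, the integers $T^p(n,k)$, for $n\ge 0$ and $0\le k\le n$, are defined by the initial conditions $T^p(0,0)=1$ and $T^p(n,n)=0$ for $n>0$, and by the recurrence, for $n>0$ and $0\le k<n$, $$T^p(n,k)=\sum_{j=0}^{k}\binom{k-j+p-2}{p-2}\,T^p(n-1,j).$$ Convention for $p=1$: $\binom{m-1}{ -1}$ is understood to be $1$ if $m=0$ and $0$ if $m>0$, so that the recurrence reads $T^1(n,k)=T^1(n-1,k)$, giving $T^1(n,0)=1$ for $n>0$ and $T^1(n,k)=0$ for $k>0$. -}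

module Defs where

open import Data.Bool.Base using (if_then_else_)
open import Data.Fin.Base using (toℕ)
open import Data.Integer.Base using (+_)
open import Data.Nat.Base using (ℕ; zero; suc; _+_; _*_; _∸_; _≤ᵇ_; NonZero)
open import Data.Nat.Combinatorics using (_C_)
open import Data.Nat.Properties using (+-*-semiring)
open import Data.Rational.Base as ℚ using (ℚ; _/_)

open import Algebra.Properties.Semiring.Sum +-*-semiring public using (sum⁺-syntax)

-- The binomial coefficient (m + p - 2 choose p - 2) for p > 0, where for
-- p = 1 the symbol (m - 1 choose -1) means 1 if m = 0 and 0 if m > 0.
coeff : (p : ℕ) .{{_ : NonZero p}} → ℕ → ℕ
coeff (suc zero)    zero    = 1
coeff (suc zero)    (suc _) = 0
coeff (suc (suc q)) m       = (m + q) C q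

-- The numbers Tᵖ(n, k) for 0 ≤ k ≤ n, extended by 0 to k > n.  For row
-- suc n the recurrence applies when k < suc n, that is, k ≤ n; the
-- remaining branch contains the boundary condition Tᵖ(suc n, suc n) = 0.
T : (p : ℕ) .{{_ : NonZero p}} → ℕ → ℕ → ℕ
T p zero    zero    = 1
T p zero    (suc _) = 0
T p (suc n) k       =
  if k ≤ᵇ n then ∑[ j ≤ k ] (coeff p (k ∸ toℕ j) * T p n (toℕ j)) else 0

-- Defined in ℚ, so that the division is exact; integrality is not assumed.
fussCatalan : ℕ → ℕ → ℚ
fussCatalan p n = (+ 1 / suc (p * n)) ℚ.* (+ (suc (p * n) C n) / 1)

{-# OPTIONS --safe #-}

-- In terms of generating functions, row n of the triangle agrees up to degree n
-- with (1 − p x) / (1 − x)^(r n + 1), where p = r + 1: the recurrence multiplies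
-- row n − 1 by (1 − x)^(−r), and cutting row n off at degree n is harmless because
-- the coefficient of degree n > 0 of this series vanishes.  The sum of row n is
-- the coefficient of degree n after one more multiplication by 1 / (1 − x).
-- To stay in ℕ, "f is (1 − p x) u" is written f + p x u = u.
module Submission where

open import Defs
open import Data.Bool.Base using (true; false)
open import Data.Fin.Base using (toℕ)
open import Data.Fin.Properties using (toℕ≤pred[n])
open import Data.Integer.Base as ℤ using (+_)
import Data.Integer.Properties as ℤ
open import Data.Nat.Base
  using (ℕ; zero; suc; _+_; _*_; _∸_; _≤_; _≤ᵇ_; z≤n; s≤s; NonZero)
open import Data.Nat.Combinatorics using (_C_; nCn≡1; nCk≡nC[n∸k]; nCk+nC[k+1]≡[n+1]C[k+1])
open import Data.Nat.Properties
open import Data.Nat.Tactic.RingSolver using (solve-∀)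
open import Data.Rational.Base as ℚ using (_/_; toℚᵘ)
open import Data.Rational.Properties using (toℚᵘ-injective; toℚᵘ-fromℚᵘ; toℚᵘ-homo-*)
open import Data.Rational.Unnormalised.Base as ℚᵘ using (mkℚᵘ; *≡*)
import Data.Rational.Unnormalised.Properties as ℚᵘ
open import Data.Sum.Base using (inj₁; inj₂)
open import Function.Base using (_∘_)
open import Relation.Nullary.Reflects using (ofʸ; ofⁿ)
open import Relation.Nullary.Negation using (contradiction)
open import Relation.Binary.PropositionalEquality
  using (_≡_; refl; sym; trans; cong; cong₂; module ≡-Reasoning)
open import Algebra.Properties.Semiring.Sum +-*-semiring
  using (sum-cong-≗; ∑-distrib-+; *-distribˡ-sum)

open ≡-Reasoning

-- Coefficients of the powers of 1 / (1 - x).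

-- The coefficient of x^k in (1 − x)^(−a).
multichoose : ℕ → ℕ → ℕ
multichoose _       zero    = 1
multichoose zero    (suc _) = 0
multichoose (suc a) (suc k) = multichoose a (suc k) + multichoose (suc a) k

multichoose-C : ∀ a k → multichoose (suc a) k ≡ (a + k) C k
multichoose-C a       zero    = refl
multichoose-C zero    (suc k) = begin
  multichoose 1 k  ≡⟨ multichoose-C zero k ⟩
  k C k            ≡⟨ nCn≡1 k ⟩
  1                ≡⟨ nCn≡1 (suc k) ⟨
  suc k C suc k    ∎
multichoose-C (suc a) (suc k) = begin
  multichoose (suc a) (suc k) + multichoose (suc (suc a)) k
    ≡⟨ cong₂ _+_ (multichoose-C a (suc k)) (multichoose-C (suc a) k) ⟩
  (a + suc k) C suc k + (suc a + k) C k
    ≡⟨ cong (λ n → (a + suc k) C suc k + n C k) (+-suc a k) ⟨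
  (a + suc k) C suc k + (a + suc k) C k
    ≡⟨ +-comm ((a + suc k) C suc k) _ ⟩
  (a + suc k) C k + (a + suc k) C suc k
    ≡⟨ nCk+nC[k+1]≡[n+1]C[k+1] (a + suc k) k ⟩
  (suc a + suc k) C suc k ∎

multichoose-1 : ∀ k → multichoose 1 k ≡ 1
multichoose-1 k = trans (multichoose-C zero k) (nCn≡1 k)

-- With p = r + 1 the weights of the recurrence are the coefficients of (1 - x)^(-r); the convention
-- for p = 1 is the case (1 - x)^0 = 1.
coeff-multichoose : ∀ r m → coeff (suc r) m ≡ multichoose r m
coeff-multichoose zero    zero    = refl
coeff-multichoose zero    (suc m) = refl
coeff-multichoose (suc q) m       = begin
  (m + q) C q            ≡⟨ nCk≡nC[n∸k] (m≤n+m q m) ⟩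
  (m + q) C (m + q ∸ q)  ≡⟨ cong₂ _C_ (+-comm m q) (m+n∸n≡m m q) ⟩
  (q + m) C m            ≡⟨ multichoose-C q m ⟨
  multichoose (suc q) m  ∎

mutual
  -- The ratio of consecutive coefficients, used both for the vanishing on the diagonal and for the
  -- factor p n + 1 in the row sum.
  absorption : ∀ a k → suc k * multichoose a (suc k) ≡ (a + k) * multichoose a k
  absorption a k = trans (absorption-suc a k) (suc-absorption a k)

  -- Coefficient form of: the derivative of (1 - x)^(-a) is a (1 - x)^(-a-1).
  absorption-suc : ∀ a k → suc k * multichoose a (suc k) ≡ a * multichoose (suc a) k
  absorption-suc zero    k = *-zeroʳ (suc k)
  absorption-suc (suc a) k = begin
    suc k * (multichoose a (suc k) + y)      ≡⟨ *-distribˡ-+ (suc k) (multichoose a (suc k)) y ⟩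
    suc k * multichoose a (suc k) + suc k * y ≡⟨ cong (_+ suc k * y) (absorption-suc a k) ⟩
    a * y + suc k * y                        ≡⟨ *-distribʳ-+ y a (suc k) ⟨
    (a + suc k) * y                          ≡⟨ cong (_* y) (+-suc a k) ⟩
    (suc a + k) * y                          ≡⟨ suc-absorption (suc a) k ⟨
    suc a * multichoose (suc (suc a)) k      ∎
    where y = multichoose (suc a) k

  -- The operator x d/dx + a sends (1 - x)^(-a) to a (1 - x)^(-a-1).
  suc-absorption : ∀ a k → a * multichoose (suc a) k ≡ (a + k) * multichoose a k
  suc-absorption a zero    = cong (_* 1) (sym (+-identityʳ a))
  suc-absorption a (suc k) = begin
    a * (x + multichoose (suc a) k)      ≡⟨ *-distribˡ-+ a x _ ⟩
    a * x + a * multichoose (suc a) k    ≡⟨ cong (λ w → a * x + w) (absorption-suc a k) ⟨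
    a * x + suc k * x                    ≡⟨ *-distribʳ-+ x a (suc k) ⟨
    (a + suc k) * x                      ∎
    where x = multichoose a (suc k)

-- Products of power series.

convolve : (ℕ → ℕ) → (ℕ → ℕ) → ℕ → ℕ
convolve g f k = ∑[ j ≤ k ] (g (k ∸ toℕ j) * f (toℕ j))

convolve-cong : ∀ {g g′ f f′} k → (∀ i → g i ≡ g′ i) → (∀ j → j ≤ k → f j ≡ f′ j) →
                convolve g f k ≡ convolve g′ f′ k
convolve-cong k g≗g′ f≗f′ =
  sum-cong-≗ {suc k} λ j → cong₂ _*_ (g≗g′ (k ∸ toℕ j)) (f≗f′ (toℕ j) (toℕ≤pred[n] j))

convolve-+* : ∀ g f c f′ k →
  convolve g (λ j → f j + c * f′ j) k ≡ convolve g f k + c * convolve g f′ k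
convolve-+* g f c f′ k = begin
  convolve g (λ j → f j + c * f′ j) k
    ≡⟨ sum-cong-≗ {suc k} (λ j → distrib (g (k ∸ toℕ j)) (f (toℕ j)) c (f′ (toℕ j))) ⟩
  (∑[ j ≤ k ] (term f j + c * term f′ j))
    ≡⟨ ∑-distrib-+ {suc k} (term f) (λ j → c * term f′ j) ⟩
  convolve g f k + (∑[ j ≤ k ] (c * term f′ j))
    ≡⟨ cong (λ w → convolve g f k + w) (*-distribˡ-sum {suc k} c (term f′)) ⟨
  convolve g f k + c * convolve g f′ k ∎
  where
    term = λ (h : ℕ → ℕ) j → g (k ∸ toℕ j) * h (toℕ j)
    distrib : ∀ x y z w → x * (y + z * w) ≡ x * y + z * (x * w)
    distrib = solve-∀

convolve-multichoose-0 : ∀ f k → convolve (multichoose 0) f k ≡ f k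
convolve-multichoose-0 f zero    = trans (+-identityʳ (1 * f 0)) (*-identityˡ (f 0))
-- The j = 0 term has weight `multichoose 0 (suc k)`, which computes to 0, so the goal is already
-- the claim for `f ∘ suc`.
convolve-multichoose-0 f (suc k) = convolve-multichoose-0 (f ∘ suc) k

-- Comes from (1 - x)^(-a-1) = (1 - x)^(-a) + x (1 - x)^(-a-1), multiplied by `f`. The induction
-- peels off the j = 0 term and passes to `f ∘ suc`.
convolve-multichoose-suc : ∀ a f k →
  convolve (multichoose (suc a)) f (suc k) ≡
  convolve (multichoose a) f (suc k) + convolve (multichoose (suc a)) f k
convolve-multichoose-suc a f zero    =
  rearrange (multichoose a 1) (f 0) (f 1)
  where
    rearrange : ∀ x y z →
      (x + 1) * y + (1 * z + 0) ≡ x * y + (1 * z + 0) + (1 * y + 0)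
    rearrange = solve-∀
convolve-multichoose-suc a f (suc k) = begin
  (x + y) * f 0 + convolve (multichoose (suc a)) (f ∘ suc) (suc k)
    ≡⟨ cong (λ w → (x + y) * f 0 + w) (convolve-multichoose-suc a (f ∘ suc) k) ⟩
  (x + y) * f 0 + (u + v)
    ≡⟨ rearrange x y (f 0) u v ⟩
  x * f 0 + u + (y * f 0 + v) ∎
  where
    x = multichoose a (suc (suc k))
    y = multichoose (suc a) (suc k)
    u = convolve (multichoose a) (f ∘ suc) (suc k)
    v = convolve (multichoose (suc a)) (f ∘ suc) k
    rearrange : ∀ x y z u v → (x + y) * z + (u + v) ≡ x * z + u + (y * z + v)
    rearrange = solve-∀

-- By `convolve-multichoose-suc` the left side obeys the recursion that defines `multichoose`, so
-- exponents add.
vandermonde : ∀ a b k → convolve (multichoose a) (multichoose b) k ≡ multichoose (a + b) k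
vandermonde zero    b k       = convolve-multichoose-0 (multichoose b) k
vandermonde (suc a) b zero    = refl
vandermonde (suc a) b (suc k) =
  trans (convolve-multichoose-suc a (multichoose b) k)
        (cong₂ _+_ (vandermonde a b (suc k)) (vandermonde (suc a) b k))

-- Multiplication by x.
shift : (ℕ → ℕ) → ℕ → ℕ
shift f zero    = 0
shift f (suc k) = f k

convolve-shift : ∀ g f k → convolve g (shift f) k ≡ shift (convolve g f) k
convolve-shift g f zero    = trans (+-identityʳ (g 0 * 0)) (*-zeroʳ (g 0))
convolve-shift g f (suc k) = cong (_+ convolve g f k) (*-zeroʳ (g (suc k)))

shift-cong : ∀ {f g} → (∀ k → f k ≡ g k) → ∀ k → shift f k ≡ shift g k
shift-cong f≗g zero    = refl
shift-cong f≗g (suc k) = f≗g k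

-- Rows of the triangle as truncated series.

-- f agrees with (1 − p x) / (1 − x)^a at degree k.
Agrees : ℕ → ℕ → (ℕ → ℕ) → ℕ → Set
Agrees p a f k = f k + p * shift (multichoose a) k ≡ multichoose a k

-- The additive identity is multiplied by (1 - x)^(-b). Degree k of a product involves only degrees
-- up to k of the factors, so a truncated `f` suffices.
convolve-agrees : ∀ p a b f k → (∀ j → j ≤ k → Agrees p a f j) →
                  Agrees p (b + a) (convolve (multichoose b) f) k
convolve-agrees p a b f k agrees = begin
  convolve g f k + p * shift (multichoose (b + a)) k
    ≡⟨ cong (λ x → convolve g f k + p * x) (shift-cong (vandermonde b a) k) ⟨
  convolve g f k + p * shift (convolve g (multichoose a)) k
    ≡⟨ cong (λ x → convolve g f k + p * x) (convolve-shift g (multichoose a) k) ⟨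
  convolve g f k + p * convolve g (shift (multichoose a)) k
    ≡⟨ convolve-+* g f p (shift (multichoose a)) k ⟨
  convolve g (λ j → f j + p * shift (multichoose a) j) k
    ≡⟨ convolve-cong {g} k (λ _ → refl) agrees ⟩
  convolve g (multichoose a) k
    ≡⟨ vandermonde b a k ⟩
  multichoose (b + a) k ∎
  where g = multichoose b

T-recurrence : ∀ r n k → k ≤ n →
               T (suc r) (suc n) k ≡ convolve (multichoose r) (T (suc r) n) k
T-recurrence r n k k≤n with k ≤ᵇ n | ≤ᵇ-reflects-≤ k n
... | true  | _       =
  convolve-cong {coeff (suc r)} {f = T (suc r) n} k (coeff-multichoose r) (λ _ _ → refl)
... | false | ofⁿ k≰n = contradiction k≤n k≰n

T-boundary : ∀ p .{{_ : NonZero p}} n → T p (suc n) (suc n) ≡ 0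
T-boundary p n with suc n ≤ᵇ n | ≤ᵇ-reflects-≤ (suc n) n
... | true  | ofʸ 1+n≤n = contradiction 1+n≤n 1+n≰n
... | false | _         = refl

T-agrees : ∀ r n k → k ≤ n → Agrees (suc r) (suc (n * r)) (T (suc r) n) k
T-agrees r zero    zero z≤n = cong suc (*-zeroʳ r)
T-agrees r (suc n) k k≤1+n with m≤n⇒m<n∨m≡n k≤1+n
-- Below the diagonal only entries j ≤ k ≤ n of the previous row enter, all covered by the induction
-- hypothesis.
... | inj₁ (s≤s k≤n) = begin
  T p (suc n) k + p * shift (multichoose (suc (r + n * r))) k
    ≡⟨ cong₂ (λ x a → x + p * shift (multichoose a) k)
         (T-recurrence r n k k≤n) (sym (+-suc r (n * r))) ⟩
  convolve (multichoose r) (T p n) k + p * shift (multichoose (r + suc (n * r))) k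
    ≡⟨ convolve-agrees p (suc (n * r)) r (T p n) k
         (λ j j≤k → T-agrees r n j (≤-trans j≤k k≤n)) ⟩
  multichoose (r + suc (n * r)) k
    ≡⟨ cong (λ a → multichoose a k) (+-suc r (n * r)) ⟩
  multichoose (suc (r + n * r)) k ∎
  where p = suc r
-- On the diagonal the entry is 0, so the two coefficients must cancel: after scaling by n + 1,
-- `absorption` reduces this to (n + 1) p = a + n.
... | inj₂ refl = begin
  T p (suc n) (suc n) + p * multichoose a n
    ≡⟨ cong (_+ p * multichoose a n) (T-boundary p n) ⟩
  p * multichoose a n
    ≡⟨ *-cancelˡ-≡ _ _ (suc n) diagonal ⟩
  multichoose a (suc n) ∎
  where
    p = suc r
    a = suc (suc n * r)
    rearrange : ∀ r n x →
      suc n * (suc r * x) ≡ (suc (suc n * r) + n) * x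
    rearrange = solve-∀
    diagonal : suc n * (p * multichoose a n) ≡ suc n * multichoose a (suc n)
    diagonal = trans (rearrange r n (multichoose a n)) (sym (absorption a n))

-- Summation is multiplication by 1 / (1 - x), whose coefficients are all 1. Only degree n is
-- claimed, since row n is controlled only up to there.
T-sum-agrees : ∀ r n →
  Agrees (suc r) (suc (suc (n * r))) (λ m → ∑[ k ≤ m ] T (suc r) n (toℕ k)) n
T-sum-agrees r n = begin
  (∑[ k ≤ n ] T p n (toℕ k)) + z
    ≡⟨ cong (_+ z) (sum-cong-≗ {suc n} (λ k → sym (weight (toℕ k)))) ⟩
  convolve (multichoose 1) (T p n) n + z
    ≡⟨ convolve-agrees p (suc (n * r)) 1 (T p n) n (T-agrees r n) ⟩
  multichoose (suc (suc (n * r))) n ∎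
  where
    p = suc r
    z = p * shift (multichoose (suc (suc (n * r)))) n
    weight : ∀ j → multichoose 1 (n ∸ j) * T p n j ≡ T p n j
    weight j = trans (cong (_* T p n j) (multichoose-1 (n ∸ j))) (*-identityˡ (T p n j))

-- With x and y the coefficients of degrees n and n - 1 of (1 - x)^(-a), the row sum is s = x - p y,
-- and `absorption` gives n x = N y for N = p n + 1. Hence N s = N x - p n x = x, a binomial
-- coefficient.
T-sum : ∀ p n .{{_ : NonZero p}} .{{_ : NonZero n}} →
        suc (p * n) * (∑[ k ≤ n ] T p n (toℕ k)) ≡ suc (p * n) C n
T-sum p@(suc r) n@(suc m) = trans (+-cancelʳ-≡ (p * (N * y)) (N * s) x (begin
  N * s + p * (N * y)  ≡⟨ factor N s p y ⟩
  N * (s + p * y)      ≡⟨ cong (N *_) (T-sum-agrees r n) ⟩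
  x + p * n * x        ≡⟨ cong (λ w → x + w) (*-assoc p n x) ⟩
  x + p * (n * x)      ≡⟨ cong (λ w → x + p * w) (absorption a m) ⟩
  x + p * ((a + m) * y) ≡⟨ cong (λ w → x + p * (w * y)) (index₁ r m) ⟩
  x + p * (N * y)      ∎))
  (trans (multichoose-C (suc (n * r)) n) (cong (_C n) (index₂ r n)))
  where
    N = suc (p * n)
    a = suc (suc (n * r))
    s = ∑[ k ≤ n ] T p n (toℕ k)
    x = multichoose a n
    y = multichoose a m
    factor : ∀ N s p y → N * s + p * (N * y) ≡ N * (s + p * y)
    factor = solve-∀
    index₁ : ∀ r m → suc (suc (suc m * r)) + m ≡ suc (suc r * suc m)
    index₁ = solve-∀
    index₂ : ∀ r n → suc (n * r) + n ≡ suc (suc r * n)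
    index₂ = solve-∀

-- Passage to the rationals.

/-unique : ∀ d s c → suc d * s ≡ c → + s / 1 ≡ (+ 1 / suc d) ℚ.* (+ c / 1)
/-unique d s c ds≡c = toℚᵘ-injective (begin′
  toℚᵘ (+ s / 1)
    ≈⟨ toℚᵘ-fromℚᵘ (mkℚᵘ (+ s) 0) ⟩
  mkℚᵘ (+ s) 0
    -- Equality of unnormalised fractions is cross-multiplication, so no gcd has to be computed.
    ≈⟨ *≡* cross ⟩
  mkℚᵘ (+ 1) d ℚᵘ.* mkℚᵘ (+ c) 0
    ≈⟨ ℚᵘ.*-cong (toℚᵘ-fromℚᵘ (mkℚᵘ (+ 1) d)) (toℚᵘ-fromℚᵘ (mkℚᵘ (+ c) 0)) ⟨
  toℚᵘ (+ 1 / suc d) ℚᵘ.* toℚᵘ (+ c / 1)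
    ≈⟨ toℚᵘ-homo-* (+ 1 / suc d) (+ c / 1) ⟨
  toℚᵘ ((+ 1 / suc d) ℚ.* (+ c / 1)) ∎′)
  where
    open import Relation.Binary.Reasoning.Setoid ℚᵘ.≃-setoid
      renaming (begin_ to begin′_; _∎ to _∎′)
      hiding (step-≡-⟩; step-≡-⟨; step-≡-∣)
    cross : + s ℤ.* + (suc d * 1) ≡ (+ 1 ℤ.* + c) ℤ.* + 1
    cross = begin
      + s ℤ.* + (suc d * 1)    ≡⟨ cong (λ e → + s ℤ.* + e) (*-identityʳ (suc d)) ⟩
      + s ℤ.* + suc d          ≡⟨ ℤ.pos-* s (suc d) ⟨
      + (s * suc d)            ≡⟨ cong +_ (trans (*-comm s (suc d)) ds≡c) ⟩
      + c                      ≡⟨ ℤ.*-identityˡ (+ c) ⟨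
      + 1 ℤ.* + c              ≡⟨ ℤ.*-identityʳ (+ 1 ℤ.* + c) ⟨
      + 1 ℤ.* + c ℤ.* + 1      ∎

proposition2 : ∀ (p n : ℕ) .{{_ : NonZero p}} .{{_ : NonZero n}} →
    + (∑[ k ≤ n ] T p n (toℕ k)) / 1 ≡ fussCatalan p n
proposition2 p n = /-unique (p * n) _ _ (T-sum p n)
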